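{- Let $\varepsilon>0$. If the candidates'-set algorithm (described in the context) queries at each iteration a $(1+\varepsilon)$-median of the current candidates' set for the potential function $\Phi$, then at least $\Omega(\sqrt{n})$ queries are required in the worst case to detect the target $t$ in a graph $G$ with $n$ vertices, even if $G$ is a tree. That is, there is a constant $c>0$ (possibly depending on $\varepsilon$) such that for all sufficiently large $n$ there are a tree $G$ with $n$ vertices, a target $t$ in $G$, and a choice of $(1+\varepsilon)$-medians at the iterations of the algorithm, for which the algorithm makes at least $c\sqrt{n}$ queries before detecting $t$.
   Context: Graphs $G=(V,E)$ are connected, simple, undirected, with positive edge weights $w$; $d$ is the shortest-path distance, and $N(v)$ is the set of neighbors of $v$. For $u\in N(v)$, $N(v,u)=\{x\in V: d(v,x)=w(vu)+d(u,x)\}$. There is one unknown target $t\in V$. A direction query at $v$ reveals that $v=t$ if this is the case, and otherwise returns a neighbor $u\in N(v)$ with $t\in N(v,u)$. For $S\subseteq V$ and $v\in V$, $\Phi_S(v)=\sum_{u\in S}d(v,u)$. A vertex $x\in V$ is a $(1+\varepsilon)$-median of $S$ for $\Phi$ (a $(1+\varepsilon)$-approximate minimizer) if $\Phi_S(x)\le(1+\varepsilon)\min_{v\in V}\Phi_S(v)$. The candidates'-set algorithm: it maintains a set $S\subseteq V$ with $t\in S$, initially $S=V$. At each iteration it queries a vertex $v$ that is a ($(1+\varepsilon)$-)median of $S$, and, if the response is $u\in N(v)$, it replaces $S$ by $S\cap N(v,u)$. It stops when the target is revealed or $|S|=1$. -}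

module Defs where

open import Level using (Level; 0ℓ; _⊔_) renaming (suc to lsuc)
open import Algebra.Bundles using (CommutativeRing)
open import Algebra.Structures using (IsCommutativeRing)
open import Data.Bool using (if_then_else_)
open import Data.Fin using (Fin; zero; suc; inject₁; fromℕ)
open import Data.Fin.Subset using (Subset; _∈_; ∣_∣)
open import Data.Nat using (ℕ; suc) renaming (_+_ to _+ℕ_)
open import Data.Product using (Σ; ∃-syntax; _×_)
open import Data.Vec using (lookup)
open import Function.Bundles using (_⇔_)
open import Function.Definitions using (Injective)
open import Relation.Binary.Construct.Closure.ReflexiveTransitive using (Star; _◅_) renaming (ε to [])
open import Relation.Binary.Core using (Rel)
open import Relation.Binary.Definitions using (Decidable; Irreflexive; Symmetric)
open import Relation.Binary.PropositionalEquality using (_≡_; _≢_)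
open import Relation.Binary.Structures using (IsTotalOrder)
open import Relation.Nullary using (¬_)
import Algebra.Definitions.RawMonoid as RawMonoidDefinitions
import Relation.Binary.Construct.NonStrictToStrict as ToStrict

-- The standard library has no real numbers.  Scalars (edge weights, distances,
-- ε and the constant in Ω) range over an arbitrary Archimedean ordered field;
-- classically these are exactly the ordered subfields of ℝ, including ℝ itself.
record ArchimedeanOrderedField (a ℓ₁ ℓ₂ : Level) : Set (lsuc (a ⊔ ℓ₁ ⊔ ℓ₂)) where
  infix  8 -_
  infixl 7 _*_
  infixl 6 _+_
  infix  4 _≈_ _≤_
  field
    Carrier           : Set a
    _≈_               : Rel Carrier ℓ₁
    _≤_               : Rel Carrier ℓ₂
    _+_ _*_           : Carrier → Carrier → Carrier
    -_                : Carrier → Carrier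
    0# 1#             : Carrier
    isCommutativeRing : IsCommutativeRing _≈_ _+_ _*_ -_ 0# 1#
    0≉1               : ¬ (0# ≈ 1#)
    inverse           : ∀ x → ¬ (x ≈ 0#) → ∃[ y ] x * y ≈ 1#
    isTotalOrder      : IsTotalOrder _≈_ _≤_
    +-monoˡ-≤         : ∀ z {x y} → x ≤ y → x + z ≤ y + z
    *-nonNegative     : ∀ {x y} → 0# ≤ x → 0# ≤ y → 0# ≤ x * y

  commutativeRing : CommutativeRing a ℓ₁
  commutativeRing = record { isCommutativeRing = isCommutativeRing }

  open CommutativeRing commutativeRing public using (+-rawMonoid)
  open ToStrict _≈_ _≤_ public using (_<_)

  fromℕ# : ℕ → Carrier
  fromℕ# n = RawMonoidDefinitions._×_ +-rawMonoid n 1#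

  field
    archimedean : ∀ x → ∃[ n ] x ≤ fromℕ# n

module _ {a ℓ₁ ℓ₂} (K : ArchimedeanOrderedField a ℓ₁ ℓ₂) where
  open ArchimedeanOrderedField K

  -- The value of weight u v matters only when u ~ v.
  record WeightedGraph (n : ℕ) : Set (lsuc 0ℓ ⊔ a ⊔ ℓ₁ ⊔ ℓ₂) where
    infix 4 _~_
    field
      _~_        : Rel (Fin n) 0ℓ
      ~-dec      : Decidable _~_
      ~-sym      : Symmetric _~_
      ~-irrefl   : Irreflexive _≡_ _~_
      weight     : Fin n → Fin n → Carrier
      weight-sym : ∀ {u v} → u ~ v → weight u v ≈ weight v u
      weight-pos : ∀ {u v} → u ~ v → 0# < weight u v
      connected  : ∀ u v → Star _~_ u v

module _ {a ℓ₁ ℓ₂} {K : ArchimedeanOrderedField a ℓ₁ ℓ₂} where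
  open ArchimedeanOrderedField K

  module _ {n : ℕ} (G : WeightedGraph K n) where
    open WeightedGraph G

    record Cycle : Set where
      field
        {m}       : ℕ
        vertex    : Fin (3 +ℕ m) → Fin n
        injective : Injective _≡_ _≡_ vertex
        step      : ∀ i → vertex (inject₁ i) ~ vertex (suc i)
        close     : vertex (fromℕ (2 +ℕ m)) ~ vertex zero

    -- Connectedness is part of WeightedGraph.
    IsTree : Set
    IsTree = ¬ Cycle

    walkWeight : ∀ {u v} → Star _~_ u v → Carrier
    walkWeight []                = 0#
    walkWeight (_◅_ {u} {v} _ p) = weight u v + walkWeight p

    -- Weights are positive, so shortest walks and shortest paths have the same length.
    IsDistance : (Fin n → Fin n → Carrier) → Set (ℓ₁ ⊔ ℓ₂)
    IsDistance d = ∀ u v →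
      (Σ (Star _~_ u v) λ p → walkWeight p ≈ d u v) ×
      (∀ (p : Star _~_ u v) → d u v ≤ walkWeight p)

    module _ (d : Fin n → Fin n → Carrier) where

      -- x ∈ N(v,u), for u a neighbour of v
      _∈N⟨_,_⟩ : Fin n → Fin n → Fin n → Set ℓ₁
      x ∈N⟨ v , u ⟩ = d v x ≈ weight v u + d u x

      Φ : Subset n → Fin n → Carrier
      Φ S v = RawMonoidDefinitions.sum +-rawMonoid λ u → if lookup S u then d v u else 0#

      IsMedian : Subset n → Fin n → Set ℓ₂
      IsMedian S x = ∀ v → Φ S x ≤ Φ S v

      IsApproxMedian : Carrier → Subset n → Fin n → Set ℓ₂
      IsApproxMedian ε S x = ∃[ v ] IsMedian S v × Φ S x ≤ (1# + ε) * Φ S v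

      -- Detects ε t μ S k: with candidates' set S and target t, the algorithm can
      -- make exactly k further queries until t is detected (the last query counts
      -- when it reveals t).  The vertex queried is μ S, a function of the current
      -- candidates' set alone: since μ S need not lie in S, an answer may leave S
      -- unchanged, and a free choice at each iteration would let an execution be
      -- padded with arbitrarily many repetitions of such a query.
      data Detects (ε : Carrier) (t : Fin n) (μ : Subset n → Fin n) :
                   Subset n → ℕ → Set (ℓ₁ ⊔ ℓ₂) where
        singleton : ∀ {S} → ∣ S ∣ ≡ 1 → Detects ε t μ S 0
        revealed  : ∀ {S} → ∣ S ∣ ≢ 1 → IsApproxMedian ε S (μ S) →
                    μ S ≡ t → Detects ε t μ S 1
        narrowed  : ∀ {S S′ u k} → ∣ S ∣ ≢ 1 → IsApproxMedian ε S (μ S) →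
                    μ S ≢ t → μ S ~ u → t ∈N⟨ μ S , u ⟩ →
                    (∀ x → x ∈ S′ ⇔ (x ∈ S × x ∈N⟨ μ S , u ⟩)) →
                    Detects ε t μ S′ k → Detects ε t μ S (suc k)

module Submission where

-- The lower bound is witnessed by a star.  One of its leaves is so far from the
-- hub that its distance H dominates the potential: H = N n, where N ε ≥ 1 and n
-- is the number of vertices.  All other leaves are light, at distance 1.  The
-- target is the hub.
--
-- As long as the candidates' set S contains the hub, the hub minimises Φ over S
-- (potential-hub-minimal): moving to a leaf at distance b from the hub gains at
-- most b at that leaf, loses b at the hub itself, and brings no other vertex closer.
-- Moving to a light leaf raises Φ by at most n (potential-leaf-bound), whereas Φ at
-- the hub is at least H = N n as long as S contains the heavy leaf
-- (potential-hub-heavy).  Since n ≤ ε N n, every light leaf is therefore a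
-- (1+ε)-median of S (approximation-criterion).
--
-- Querying a light leaf is answered by the hub, and this answer excludes the
-- queried leaf only (step-membership).  The hub and the heavy leaf thus stay in
-- S, and the algorithm may query all n - 2 light leaves one by one before it
-- queries the hub.  It makes n - 1 queries, and n ≤ (n - 1)² as soon as n ≥ 3, so
-- c = 1 is a valid constant for every ε.

open import Defs
open import Algebra.Bundles using (CommutativeRing)
open import Data.Bool using (true; false; if_then_else_)
open import Data.Fin using (Fin; zero; suc; fromℕ; _≟_)
open import Data.Fin.Properties using (punchInᵢ≢i; suc-injective)
open import Data.Fin.Subset using (Subset; inside; outside; ⊤; ⁅_⁆; Nonempty; _∈_; _-_; ∣_∣)
open import Data.Fin.Subset.Properties
  using (nonempty?; p─⊥≡p; p─q⊆p; x∈p∧x≢y⇒x∈p-y; Empty-unique; ∣⊥∣≡0; ∣⊤∣≡n)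
open import Data.Nat using (ℕ; zero; suc; z≤n; s≤s) renaming (_≤_ to _≤ℕ_; _<_ to _<ℕ_)
import Data.Nat as ℕ
import Data.Nat.Properties as ℕ
open import Data.Product using (Σ; ∃-syntax; _×_; _,_; proj₁; proj₂)
open import Data.Sum using (inj₁; inj₂)
open import Data.Vec using ([]; _∷_; here; there; lookup)
open import Data.Vec.Functional using (removeAt)
open import Function.Base using (_∘_)
open import Function.Bundles using (_⇔_; mk⇔)
open import Relation.Binary.Bundles using (Poset)
open import Relation.Binary.Construct.Closure.ReflexiveTransitive using (Star; _◅_) renaming (ε to [])
open import Relation.Binary.PropositionalEquality
  using (_≡_; _≢_; refl; sym; trans; cong; subst)
open import Relation.Binary.Structures using (IsTotalOrder)
open import Relation.Nullary using (¬_; Dec; yes; no; does; contradiction)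
open import Algebra.Properties.CommutativeSemigroup ℕ.+-commutativeSemigroup using (interchange)
open import Algebra.Properties.CommutativeMonoid.Sum ℕ.+-0-commutativeMonoid
  using (sum; sum-remove)
import Algebra.Definitions.RawMonoid as RawMonoidDefinitions
import Algebra.Properties.Ring as RingProperties
import Algebra.Properties.Semiring.Mult as SemiringMult
import Relation.Binary.Reasoning.PartialOrder as PartialOrderReasoning

-- Sums of natural numbers

sum-mono : ∀ {n} (f g : Fin n → ℕ) → (∀ i → f i ≤ℕ g i) → sum f ≤ℕ sum g
sum-mono {zero}  f g f≤g = z≤n
sum-mono {suc n} f g f≤g =
  ℕ.+-mono-≤ (f≤g zero) (sum-mono (f ∘ suc) (g ∘ suc) (f≤g ∘ suc))

sum-mono-except : ∀ {n} (f g : Fin n → ℕ) i {b} → (∀ j → j ≢ i → f j ≤ℕ g j) →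
                  f i ≤ℕ b → sum f ≤ℕ b ℕ.+ sum g
sum-mono-except {suc n} f g i {b} f≤g fi≤b = begin
  sum f                              ≡⟨ sum-remove {i = i} f ⟩
  f i ℕ.+ sum (removeAt f i)         ≤⟨ ℕ.+-mono-≤ fi≤b others ⟩
  b ℕ.+ sum (removeAt g i)           ≤⟨ ℕ.+-monoʳ-≤ b (ℕ.m≤n+m _ (g i)) ⟩
  b ℕ.+ (g i ℕ.+ sum (removeAt g i)) ≡⟨ cong (b ℕ.+_) (sum-remove {i = i} g) ⟨
  b ℕ.+ sum g                        ∎
  where
  open ℕ.≤-Reasoning
  others : sum (removeAt f i) ≤ℕ sum (removeAt g i)
  others = sum-mono (removeAt f i) (removeAt g i) λ j → f≤g _ (punchInᵢ≢i i j)

sum-mono-shift : ∀ {n} (f g : Fin n → ℕ) b → (∀ i → f i ≤ℕ g i ℕ.+ b) →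
                 sum f ≤ℕ sum g ℕ.+ n ℕ.* b
sum-mono-shift {zero}  f g b f≤g+b = z≤n
sum-mono-shift {suc n} f g b f≤g+b = begin
  f zero ℕ.+ sum (f ∘ suc)
    ≤⟨ ℕ.+-mono-≤ (f≤g+b zero) (sum-mono-shift (f ∘ suc) (g ∘ suc) b (f≤g+b ∘ suc)) ⟩
  (g zero ℕ.+ b) ℕ.+ (sum (g ∘ suc) ℕ.+ n ℕ.* b)
    ≡⟨ interchange (g zero) b (sum (g ∘ suc)) (n ℕ.* b) ⟩
  (g zero ℕ.+ sum (g ∘ suc)) ℕ.+ (b ℕ.+ n ℕ.* b) ∎
  where open ℕ.≤-Reasoning

-- Removing an element from a finite set

x∈p⇒∣p∣≡1+∣p-x∣ : ∀ {n} {p : Subset n} {x} → x ∈ p → ∣ p ∣ ≡ suc ∣ p - x ∣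
x∈p⇒∣p∣≡1+∣p-x∣ {p = _ ∷ p}       here        = cong (suc ∘ ∣_∣) (sym (p─⊥≡p p))
x∈p⇒∣p∣≡1+∣p-x∣ {p = inside ∷ p}  (there x∈p) = cong suc (x∈p⇒∣p∣≡1+∣p-x∣ x∈p)
x∈p⇒∣p∣≡1+∣p-x∣ {p = outside ∷ p} (there x∈p) = x∈p⇒∣p∣≡1+∣p-x∣ x∈p

x∉p-x : ∀ {n} (p : Subset n) x → ¬ x ∈ p - x
x∉p-x (_ ∷ p) (suc x) (there x∈p-x) = x∉p-x p x x∈p-x

-- The metric of a star

-- The star with hub zero and leaves suc i; the edge to the leaf suc i has
-- length h i.
module StarMetric {m} (h : Fin m → ℕ) where

  dist : Fin (suc m) → Fin (suc m) → ℕ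
  dist zero    zero    = 0
  dist zero    (suc j) = h j
  dist (suc i) zero    = h i
  dist (suc i) (suc j) = if does (i ≟ j) then 0 else h i ℕ.+ h j

  dist-self : ∀ v → dist v v ≡ 0
  dist-self zero    = refl
  dist-self (suc i) with i ≟ i
  ... | yes _  = refl
  ... | no i≢i = contradiction refl i≢i

  dist-via-hub : ∀ i v → v ≢ suc i → dist (suc i) v ≡ h i ℕ.+ dist zero v
  dist-via-hub i zero    _     = sym (ℕ.+-identityʳ (h i))
  dist-via-hub i (suc j) j≢i with i ≟ j
  ... | yes refl = contradiction refl j≢i
  ... | no _     = refl

  dist-leaf-≤ : ∀ i v → dist (suc i) v ≤ℕ h i ℕ.+ dist zero v
  dist-leaf-≤ i v with v ≟ suc i
  ... | yes refl = ℕ.≤-trans (ℕ.≤-reflexive (dist-self (suc i))) z≤n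
  ... | no v≢i   = ℕ.≤-reflexive (dist-via-hub i v v≢i)

  dist-hub-≤ : ∀ i v → dist zero v ≤ℕ h i ℕ.+ dist (suc i) v
  dist-hub-≤ i zero    = z≤n
  dist-hub-≤ i (suc j) with i ≟ j
  ... | yes refl = ℕ.m≤m+n (h i) 0
  ... | no _     = ℕ.≤-trans (ℕ.m≤n+m (h j) (h i)) (ℕ.m≤n+m _ (h i))

  -- The potential Φ of the star, as a natural number.
  potential : Subset (suc m) → Fin (suc m) → ℕ
  potential S v = sum λ u → if lookup S u then dist v u else 0

  private
    if-mono : ∀ b {x y} → x ≤ℕ y → (if b then x else 0) ≤ℕ (if b then y else 0)
    if-mono true  x≤y = x≤y
    if-mono false x≤y = z≤n

    if-≤ : ∀ b {x} → (if b then x else 0) ≤ℕ x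
    if-≤ true  = ℕ.≤-refl
    if-≤ false = z≤n

    if-shift : ∀ b {x y z} → x ≤ℕ z ℕ.+ y →
               (if b then x else 0) ≤ℕ (if b then y else 0) ℕ.+ z
    if-shift true  {y = y} {z} x≤z+y = ℕ.≤-trans x≤z+y (ℕ.≤-reflexive (ℕ.+-comm z y))
    if-shift false             x≤z+y = z≤n

  -- The shape inside ∷ T says that the hub belongs to the set.
  potential-hub-minimal : ∀ T v → potential (inside ∷ T) zero ≤ℕ potential (inside ∷ T) v
  potential-hub-minimal T zero    = ℕ.≤-refl
  -- The term of the hub itself is 0 on the left and h i on the right; this h i pays
  -- for the term of the leaf suc i.
  potential-hub-minimal T (suc i) = sum-mono-except _ _ i
    (λ j j≢i → if-mono (lookup T j) (hub≤leaf j j≢i))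
    (if-≤ (lookup T i))
    where
    hub≤leaf : ∀ j → j ≢ i → dist zero (suc j) ≤ℕ dist (suc i) (suc j)
    hub≤leaf j j≢i = ℕ.≤-trans (ℕ.m≤n+m (h j) (h i))
      (ℕ.≤-reflexive (sym (dist-via-hub i (suc j) (j≢i ∘ suc-injective))))

  potential-leaf-bound : ∀ S i →
    potential S (suc i) ≤ℕ potential S zero ℕ.+ suc m ℕ.* h i
  potential-leaf-bound S i = sum-mono-shift _ _ (h i)
    λ u → if-shift (lookup S u) (dist-leaf-≤ i u)

-- Natural numbers in an Archimedean ordered field

module OrderedField {a ℓ₁ ℓ₂} (K : ArchimedeanOrderedField a ℓ₁ ℓ₂) where
  open ArchimedeanOrderedField K
  open CommutativeRing commutativeRing public
    using (semiring; ring; +-cong; +-comm; +-assoc; +-identityˡ; +-identityʳ;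
           *-cong; *-comm; *-assoc; *-identityˡ; distribˡ; distribʳ;
           -‿cong; -‿inverseˡ; -‿inverseʳ)
    renaming (refl to ≈-refl; sym to ≈-sym; trans to ≈-trans)
  open SemiringMult semiring using (×-homo-+; ×1-homo-*)
  open RingProperties ring using (-‿distribˡ-*; -‿involutive)
  open IsTotalOrder isTotalOrder public using (antisym; total)
    renaming (refl to ≤-refl; reflexive to ≤-reflexive; trans to ≤-trans)

  poset : Poset _ _ _
  poset = record { isPartialOrder = IsTotalOrder.isPartialOrder isTotalOrder }

  open PartialOrderReasoning poset

  +-monoʳ-≤ : ∀ z {x y} → x ≤ y → z + x ≤ z + y
  +-monoʳ-≤ z {x} {y} x≤y = begin
    z + x ≈⟨ +-comm z x ⟩
    x + z ≤⟨ +-monoˡ-≤ z x≤y ⟩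
    y + z ≈⟨ +-comm y z ⟩
    z + y ∎

  *-monoʳ-≤ : ∀ {z x y} → 0# ≤ z → x ≤ y → z * x ≤ z * y
  *-monoʳ-≤ {z} {x} {y} 0≤z x≤y = begin
    z * x                     ≈⟨ +-identityˡ (z * x) ⟨
    0# + z * x                ≤⟨ +-monoˡ-≤ (z * x) (*-nonNegative 0≤z 0≤y-x) ⟩
    z * (y + - x) + z * x     ≈⟨ distribˡ z (y + - x) x ⟨
    z * (y + - x + x)         ≈⟨ *-cong ≈-refl (+-assoc y (- x) x) ⟩
    z * (y + (- x + x))       ≈⟨ *-cong ≈-refl (+-cong ≈-refl (-‿inverseˡ x)) ⟩
    z * (y + 0#)              ≈⟨ *-cong ≈-refl (+-identityʳ y) ⟩
    z * y                     ∎
    where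
    0≤y-x : 0# ≤ y + - x
    0≤y-x = ≤-trans (≤-reflexive (≈-sym (-‿inverseʳ x))) (+-monoˡ-≤ (- x) x≤y)

  0≤1 : 0# ≤ 1#
  0≤1 with total 0# 1#
  ... | inj₁ 0≤1′ = 0≤1′
  ... | inj₂ 1≤0  = begin
    0#            ≤⟨ *-nonNegative 0≤-1 0≤-1 ⟩
    - 1# * - 1#   ≈⟨ -‿distribˡ-* 1# (- 1#) ⟨
    - (1# * - 1#) ≈⟨ -‿cong (*-identityˡ (- 1#)) ⟩
    - (- 1#)      ≈⟨ -‿involutive 1# ⟩
    1#            ∎
    where
    0≤-1 : 0# ≤ - 1#
    0≤-1 = begin
      0#        ≈⟨ -‿inverseʳ 1# ⟨
      1# + - 1# ≤⟨ +-monoˡ-≤ (- 1#) 1≤0 ⟩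
      0# + - 1# ≈⟨ +-identityˡ (- 1#) ⟩
      - 1#      ∎

  fromℕ#-+ : ∀ m n → fromℕ# (m ℕ.+ n) ≈ fromℕ# m + fromℕ# n
  fromℕ#-+ = ×-homo-+ 1#

  fromℕ#-* : ∀ m n → fromℕ# (m ℕ.* n) ≈ fromℕ# m * fromℕ# n
  fromℕ#-* = ×1-homo-*

  fromℕ#-cong : ∀ {m n} → m ≡ n → fromℕ# m ≈ fromℕ# n
  fromℕ#-cong refl = ≈-refl

  fromℕ#-mono : ∀ {m n} → m ≤ℕ n → fromℕ# m ≤ fromℕ# n
  fromℕ#-mono {n = zero}  z≤n = ≤-refl
  fromℕ#-mono {n = suc n} z≤n = begin
    0#               ≤⟨ fromℕ#-mono {n = n} z≤n ⟩
    fromℕ# n         ≈⟨ +-identityˡ (fromℕ# n) ⟨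
    0# + fromℕ# n    ≤⟨ +-monoˡ-≤ (fromℕ# n) 0≤1 ⟩
    1# + fromℕ# n    ∎
  fromℕ#-mono (s≤s m≤n) = +-monoʳ-≤ 1# (fromℕ#-mono m≤n)

  fromℕ#-positive : ∀ {n} → 0 <ℕ n → 0# < fromℕ# n
  fromℕ#-positive {suc n} _ = fromℕ#-mono {0} {suc n} z≤n , λ 0≈1+n → 0≉1 (antisym 0≤1 (begin
    1#            ≈⟨ +-identityʳ 1# ⟨
    1# + 0#       ≤⟨ +-monoʳ-≤ 1# (fromℕ#-mono {0} {n} z≤n) ⟩
    1# + fromℕ# n ≈⟨ 0≈1+n ⟨
    0#            ∎))

  sum-fromℕ# : ∀ {n} (f : Fin n → Carrier) (g : Fin n → ℕ) → (∀ i → f i ≈ fromℕ# (g i)) →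
               RawMonoidDefinitions.sum +-rawMonoid f ≈ fromℕ# (sum g)
  sum-fromℕ# {zero}  f g f≈g = ≈-refl
  sum-fromℕ# {suc n} f g f≈g = ≈-trans
    (+-cong (f≈g zero) (sum-fromℕ# (f ∘ suc) (g ∘ suc) (f≈g ∘ suc)))
    (≈-sym (fromℕ#-+ (g zero) (sum (g ∘ suc))))

  -- The successor makes the integer positive, so that it can scale an edge length.
  archimedean-inverse : ∀ {ε} → 0# < ε → ∃[ N ] 1# ≤ ε * fromℕ# (suc N)
  archimedean-inverse {ε} (0≤ε , 0≉ε) =
    let y , εy≈1 = inverse ε (0≉ε ∘ ≈-sym)
        N , y≤N  = archimedean y
    in N , (begin
      1#                 ≈⟨ εy≈1 ⟨
      ε * y              ≤⟨ *-monoʳ-≤ 0≤ε y≤N ⟩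
      ε * fromℕ# N       ≤⟨ *-monoʳ-≤ 0≤ε (fromℕ#-mono (ℕ.n≤1+n N)) ⟩
      ε * fromℕ# (suc N) ∎)

  -- An additive error b is a relative error of at most ε on a value p ≥ N b with
  -- N ε ≥ 1.
  approximation-criterion : ∀ {ε N b p q} → 0# ≤ ε → 1# ≤ ε * fromℕ# N →
    N ℕ.* b ≤ℕ p → q ≤ℕ p ℕ.+ b → fromℕ# q ≤ (1# + ε) * fromℕ# p
  approximation-criterion {ε} {N} {b} {p} {q} 0≤ε 1≤εN Nb≤p q≤p+b = begin
    fromℕ# q                          ≤⟨ fromℕ#-mono q≤p+b ⟩
    fromℕ# (p ℕ.+ b)                  ≈⟨ fromℕ#-+ p b ⟩
    fromℕ# p + fromℕ# b               ≤⟨ +-monoʳ-≤ (fromℕ# p) b≤εp ⟩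
    fromℕ# p + ε * fromℕ# p           ≈⟨ +-cong (*-identityˡ (fromℕ# p)) ≈-refl ⟨
    1# * fromℕ# p + ε * fromℕ# p      ≈⟨ distribʳ (fromℕ# p) 1# ε ⟨
    (1# + ε) * fromℕ# p               ∎
    where
    b≤εp : fromℕ# b ≤ ε * fromℕ# p
    b≤εp = begin
      fromℕ# b                   ≈⟨ *-identityˡ (fromℕ# b) ⟨
      1# * fromℕ# b              ≈⟨ *-comm 1# (fromℕ# b) ⟩
      fromℕ# b * 1#              ≤⟨ *-monoʳ-≤ (fromℕ#-mono {0} {b} z≤n) 1≤εN ⟩
      fromℕ# b * (ε * fromℕ# N)  ≈⟨ *-comm (fromℕ# b) (ε * fromℕ# N) ⟩
      (ε * fromℕ# N) * fromℕ# b  ≈⟨ *-assoc ε (fromℕ# N) (fromℕ# b) ⟩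
      ε * (fromℕ# N * fromℕ# b)  ≈⟨ *-cong ≈-refl (fromℕ#-* N b) ⟨
      ε * fromℕ# (N ℕ.* b)       ≤⟨ *-monoʳ-≤ 0≤ε (fromℕ#-mono Nb≤p) ⟩
      ε * fromℕ# p               ∎

-- Stars as weighted trees

-- The edges of the star, in both directions.
data StarEdge {m} : Fin (suc m) → Fin (suc m) → Set where
  outward : ∀ {i} → StarEdge zero (suc i)
  inward  : ∀ {i} → StarEdge (suc i) zero

module StarGraph {a ℓ₁ ℓ₂} (K : ArchimedeanOrderedField a ℓ₁ ℓ₂)
                 {m} (h : Fin m → ℕ) (h-positive : ∀ i → 0 <ℕ h i) where
  open ArchimedeanOrderedField K
  open OrderedField K
  open StarMetric h
  open PartialOrderReasoning poset

  d : Fin (suc m) → Fin (suc m) → Carrier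
  d u v = fromℕ# (dist u v)

  -- The weight of an edge is the distance between its ends.
  star : WeightedGraph K (suc m)
  star = record
    { _~_        = StarEdge
    ; ~-dec      = edge?
    ; ~-sym      = λ { outward → inward ; inward → outward }
    ; ~-irrefl   = λ { refl () }
    ; weight     = d
    ; weight-sym = λ { outward → ≈-refl ; inward → ≈-refl }
    ; weight-pos = λ { (outward {i}) → fromℕ#-positive (h-positive i)
                     ; (inward {i}) → fromℕ#-positive (h-positive i) }
    ; connected  = λ { zero    zero    → []
                     ; zero    (suc j) → outward ◅ []
                     ; (suc i) zero    → inward ◅ []
                     ; (suc i) (suc j) → inward ◅ outward ◅ [] }
    }
    where
    edge? : ∀ u v → Dec (StarEdge u v)
    edge? zero    zero    = no λ ()
    edge? zero    (suc j) = yes outward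
    edge? (suc i) zero    = yes inward
    edge? (suc i) (suc j) = no λ ()

  -- Among three consecutive vertices of a cycle, the hub is either the middle one
  -- or both of the outer ones.  In the first case the hub also precedes the first
  -- vertex, so it is repeated in either case.
  star-isTree : IsTree star
  star-isTree C = no-cycle (step zero) (step (suc zero)) close refl refl refl refl
    where
    open Cycle C
    no-cycle : ∀ {u v w z} → StarEdge u v → StarEdge v w → StarEdge z u →
               vertex zero ≡ u → vertex (suc zero) ≡ v → vertex (suc (suc zero)) ≡ w →
               ¬ vertex (fromℕ (2 ℕ.+ Cycle.m C)) ≡ z
    no-cycle outward inward  _      eq₀ _   eq₂ _   with () ← injective (trans eq₀ (sym eq₂))
    no-cycle inward  outward outward _  eq₁ _   eqₗ with () ← injective (trans eq₁ (sym eqₗ))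

  dist-isDistance : IsDistance star d
  dist-isDistance u v = shortest u v , lower-bound
    where
    edge-triangle : ∀ {u x} v → StarEdge u x → dist u v ≤ℕ dist u x ℕ.+ dist x v
    edge-triangle v (outward {i}) = dist-hub-≤ i v
    edge-triangle v (inward {i})  = dist-leaf-≤ i v

    lower-bound : ∀ {u v} (p : Star StarEdge u v) → d u v ≤ walkWeight star p
    lower-bound {u} []                    = ≤-reflexive (fromℕ#-cong (dist-self u))
    lower-bound {u} {v} (_◅_ {j = x} e p) = begin
      d u v                          ≤⟨ fromℕ#-mono (edge-triangle v e) ⟩
      fromℕ# (dist u x ℕ.+ dist x v) ≈⟨ fromℕ#-+ (dist u x) (dist x v) ⟩
      d u x + d x v                  ≤⟨ +-monoʳ-≤ (d u x) (lower-bound p) ⟩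
      d u x + walkWeight star p      ∎

    shortest : ∀ u v → Σ (Star StarEdge u v) λ p → walkWeight star p ≈ d u v
    shortest zero    zero    = [] , ≈-refl
    shortest zero    (suc j) = outward ◅ [] , +-identityʳ _
    shortest (suc i) zero    = inward ◅ [] , +-identityʳ _
    shortest (suc i) (suc j) with i ≟ j
    ... | yes refl = [] , ≈-refl
    ... | no _     = inward ◅ outward ◅ [] ,
      ≈-trans (+-cong ≈-refl (+-identityʳ _)) (≈-sym (fromℕ#-+ (h i) (h j)))

  Φ≈potential : ∀ S v → Φ star d S v ≈ fromℕ# (potential S v)
  Φ≈potential S v = sum-fromℕ#
    (λ u → if lookup S u then d v u else 0#) (λ u → if lookup S u then dist v u else 0)
    (λ u → if-fromℕ# (lookup S u) (dist v u))
    where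
    if-fromℕ# : ∀ b x → (if b then fromℕ# x else 0#) ≈ fromℕ# (if b then x else 0)
    if-fromℕ# true  x = ≈-refl
    if-fromℕ# false x = ≈-refl

  hub-isMedian : ∀ T → IsMedian star d (inside ∷ T) zero
  hub-isMedian T v = begin
    Φ star d (inside ∷ T) zero            ≈⟨ Φ≈potential (inside ∷ T) zero ⟩
    fromℕ# (potential (inside ∷ T) zero)  ≤⟨ fromℕ#-mono (potential-hub-minimal T v) ⟩
    fromℕ# (potential (inside ∷ T) v)     ≈⟨ Φ≈potential (inside ∷ T) v ⟨
    Φ star d (inside ∷ T) v               ∎

  isApproxMedian : ∀ {ε N b} T v → 0# ≤ ε → 1# ≤ ε * fromℕ# N →
    N ℕ.* b ≤ℕ potential (inside ∷ T) zero →
    potential (inside ∷ T) v ≤ℕ potential (inside ∷ T) zero ℕ.+ b →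
    IsApproxMedian star d ε (inside ∷ T) v
  isApproxMedian {ε} {N} T v 0≤ε 1≤εN Nb≤hub v≤hub+b = zero , hub-isMedian T , (begin
    Φ star d (inside ∷ T) v                          ≈⟨ Φ≈potential (inside ∷ T) v ⟩
    fromℕ# (potential (inside ∷ T) v)
      ≤⟨ approximation-criterion {N = N} 0≤ε 1≤εN Nb≤hub v≤hub+b ⟩
    (1# + ε) * fromℕ# (potential (inside ∷ T) zero)
      ≈⟨ *-cong ≈-refl (Φ≈potential (inside ∷ T) zero) ⟨
    (1# + ε) * Φ star d (inside ∷ T) zero            ∎)

  -- The answer zero to a query at a leaf is consistent with every other vertex.
  leaf-answer : ∀ i v → v ≢ suc i → _∈N⟨_,_⟩ star d v (suc i) zero
  leaf-answer i v v≢i =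
    ≈-trans (fromℕ#-cong (dist-via-hub i v v≢i)) (fromℕ#-+ (h i) (dist zero v))

  leaf-excluded : ∀ i → ¬ _∈N⟨_,_⟩ star d (suc i) (suc i) zero
  leaf-excluded i self∈N = proj₂ (fromℕ#-positive {h i ℕ.+ h i} 0<2h) (begin-equality
    0#                                        ≡⟨⟩
    fromℕ# 0                                  ≈⟨ fromℕ#-cong (dist-self (suc i)) ⟨
    d (suc i) (suc i)                         ≈⟨ self∈N ⟩
    fromℕ# (h i) + fromℕ# (h i)               ≈⟨ fromℕ#-+ (h i) (h i) ⟨
    fromℕ# (h i ℕ.+ h i)                      ∎)
    where
    0<2h : 0 <ℕ h i ℕ.+ h i
    0<2h = ℕ.<-≤-trans (h-positive i) (ℕ.m≤m+n (h i) (h i))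

  -- The answer zero to a query at suc i removes exactly suc i from the candidates.
  step-membership : ∀ S i x → x ∈ S - suc i ⇔ (x ∈ S × _∈N⟨_,_⟩ star d x (suc i) zero)
  step-membership S i x = mk⇔
    (λ x∈S-i → p─q⊆p S ⁅ suc i ⁆ x∈S-i ,
               leaf-answer i x λ { refl → x∉p-x S (suc i) x∈S-i })
    (λ { (x∈S , x∈N) → x∈p∧x≢y⇒x∈p-y {y = suc i} x∈S λ { refl → leaf-excluded i x∈N } })

  module _ {ε : Carrier} {μ : Subset (suc m) → Fin (suc m)} where

    query-hub : ∀ {S} → ∣ S ∣ ≢ 1 → μ S ≡ zero → IsApproxMedian star d ε S zero →
                Detects star d ε zero μ S 1
    query-hub {S} ∣S∣≢1 μS≡hub median =
      revealed ∣S∣≢1 (subst (IsApproxMedian star d ε S) (sym μS≡hub) median) μS≡hub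

    query-leaf : ∀ {S i k} → ∣ S ∣ ≢ 1 → μ S ≡ suc i → IsApproxMedian star d ε S (suc i) →
                 Detects star d ε zero μ (S - suc i) k →
                 Detects star d ε zero μ S (suc k)
    query-leaf {S} {i} ∣S∣≢1 μS≡leaf median = narrow μS≡leaf median (λ ()) inward
      (leaf-answer i zero λ ()) (step-membership S i)
      where
      -- The queried vertex is a variable here so that the equation can be matched.
      narrow : ∀ {v u S′ k} → μ S ≡ v → IsApproxMedian star d ε S v → v ≢ zero →
               StarEdge v u → _∈N⟨_,_⟩ star d zero v u →
               (∀ x → x ∈ S′ ⇔ (x ∈ S × _∈N⟨_,_⟩ star d x v u)) →
               Detects star d ε zero μ S′ k → Detects star d ε zero μ S (suc k)
      narrow refl = narrowed ∣S∣≢1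

-- The execution on a star with one heavy leaf

-- The heavy leaf is at distance (1 + N) n from the hub, where n = 2 + m is the number
-- of vertices.
module HeavyStar {a ℓ₁ ℓ₂} (K : ArchimedeanOrderedField a ℓ₁ ℓ₂) (N m : ℕ) where
  open ArchimedeanOrderedField K

  -- The heavy leaf is the first one; m light leaves follow.  The trailing factor 1
  -- is the length of the edge to a light leaf, so that height zero is suc N times
  -- the error in potential-leaf-bound.
  height : Fin (suc m) → ℕ
  height zero    = suc N ℕ.* ((2 ℕ.+ m) ℕ.* 1)
  height (suc _) = 1

  height-positive : ∀ i → 0 <ℕ height i
  height-positive zero    = s≤s z≤n
  height-positive (suc _) = s≤s z≤n

  open StarMetric height using (potential; potential-leaf-bound)
  open StarGraph K height height-positive public

  potential-hub-heavy : ∀ T → height zero ≤ℕ potential (inside ∷ inside ∷ T) zero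
  potential-hub-heavy T = ℕ.m≤m+n (height zero) _

  -- A function of the decision alone, so that the decision can be replaced by its
  -- known outcome.
  choose : ∀ {T : Subset m} → Dec (Nonempty T) → Fin (2 ℕ.+ m)
  choose (yes (i , _)) = suc (suc i)
  choose (no _)        = zero

  -- The vertex to query: some light candidate if there is one, the hub otherwise.
  query : Subset (2 ℕ.+ m) → Fin (2 ℕ.+ m)
  query (_ ∷ _ ∷ T) = choose (nonempty? T)

  module _ {ε : Carrier} (0≤ε : 0# ≤ ε) (1≤εN : 1# ≤ ε * fromℕ# (suc N)) where

    hub-isApproxMedian : ∀ T → IsApproxMedian star d ε (inside ∷ T) zero
    hub-isApproxMedian T = isApproxMedian {N = suc N} {b = 0} T zero 0≤ε 1≤εN
      (ℕ.≤-trans (ℕ.≤-reflexive (ℕ.*-zeroʳ (suc N))) z≤n) (ℕ.m≤m+n _ 0)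

    light-isApproxMedian : ∀ T i → IsApproxMedian star d ε (inside ∷ inside ∷ T) (suc (suc i))
    light-isApproxMedian T i = isApproxMedian {N = suc N} (inside ∷ T) (suc (suc i))
      0≤ε 1≤εN (potential-hub-heavy T) (potential-leaf-bound (inside ∷ inside ∷ T) (suc i))

    -- T is the set of the remaining light candidates: each costs one query, and one
    -- more query reveals the hub.
    detects : ∀ k T → ∣ T ∣ ≡ k →
              Detects star d ε zero query (inside ∷ inside ∷ T) (suc k)
    detects k T ∣T∣≡k with nonempty? T in eq
    detects zero    T ∣T∣≡0   | no _ =
      query-hub (λ ()) (cong choose eq) (hub-isApproxMedian (inside ∷ T))
    detects (suc k) T ∣T∣≡1+k | no T-empty = contradiction
      (trans (sym ∣T∣≡1+k) (trans (cong ∣_∣ (Empty-unique T-empty)) (∣⊥∣≡0 m))) λ ()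
    detects zero    T ∣T∣≡0   | yes (i , i∈T) = contradiction
      (trans (sym (x∈p⇒∣p∣≡1+∣p-x∣ i∈T)) ∣T∣≡0) λ ()
    detects (suc k) T ∣T∣≡1+k | yes (i , i∈T) =
      query-leaf (λ ()) (cong choose eq) (light-isApproxMedian T i)
        (detects k (T - i) (ℕ.suc-injective (trans (sym (x∈p⇒∣p∣≡1+∣p-x∣ i∈T)) ∣T∣≡1+k)))

theorem3 : ∀ {a ℓ₁ ℓ₂} (K : ArchimedeanOrderedField a ℓ₁ ℓ₂) →
    let open ArchimedeanOrderedField K in
    (ε : Carrier) → 0# < ε →
    Σ Carrier λ c → 0# < c ×
    (Σ ℕ λ n₀ → ∀ n → n₀ ≤ℕ n →
    Σ (WeightedGraph K n) λ G → IsTree G ×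
    (Σ (Fin n → Fin n → Carrier) λ d → IsDistance G d ×
    (Σ (Fin n) λ t → Σ (Subset n → Fin n) λ μ → Σ ℕ λ k →
    Detects G d ε t μ ⊤ k ×
    (c * c) * fromℕ# n ≤ fromℕ# k * fromℕ# k)))
theorem3 K ε 0<ε@(0≤ε , _) = 1# , (0≤1 , 0≉1) , 3 , construction
  where
  open ArchimedeanOrderedField K
  open OrderedField K

  -- There are 3 + m vertices, 1 + m of them light leaves, hence 2 + m queries.
  n≤k² : ∀ m → 3 ℕ.+ m ≤ℕ (2 ℕ.+ m) ℕ.* (2 ℕ.+ m)
  n≤k² m = ℕ.≤-trans (ℕ.≤-reflexive (ℕ.+-comm 1 (2 ℕ.+ m))) (ℕ.+-monoʳ-≤ (2 ℕ.+ m) (s≤s z≤n))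

  construction : ∀ n → 3 ≤ℕ n →
    Σ (WeightedGraph K n) λ G → IsTree G ×
    (Σ (Fin n → Fin n → Carrier) λ d → IsDistance G d ×
    (Σ (Fin n) λ t → Σ (Subset n → Fin n) λ μ → Σ ℕ λ k →
    Detects G d ε t μ ⊤ k ×
    (1# * 1#) * fromℕ# n ≤ fromℕ# k * fromℕ# k))
  construction (suc (suc (suc m))) (s≤s (s≤s (s≤s _))) =
    star , star-isTree , d , dist-isDistance , zero , query , 2 ℕ.+ m ,
    detects 0≤ε (proj₂ inv) (suc m) ⊤ (∣⊤∣≡n (suc m)) , (begin
      (1# * 1#) * fromℕ# (3 ℕ.+ m)            ≈⟨ *-cong (*-identityˡ 1#) ≈-refl ⟩
      1# * fromℕ# (3 ℕ.+ m)                   ≈⟨ *-identityˡ _ ⟩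
      fromℕ# (3 ℕ.+ m)                        ≤⟨ fromℕ#-mono (n≤k² m) ⟩
      fromℕ# ((2 ℕ.+ m) ℕ.* (2 ℕ.+ m))        ≈⟨ fromℕ#-* (2 ℕ.+ m) (2 ℕ.+ m) ⟩
      fromℕ# (2 ℕ.+ m) * fromℕ# (2 ℕ.+ m)     ∎)
    where
    inv = archimedean-inverse 0<ε
    open HeavyStar K (proj₁ inv) (suc m)
    open PartialOrderReasoning poset
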